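{- For every nonnegative integer $n$, $C_1(n)=C_2(n)$, where: (i) $C_1(n)$ is the number of partitions of $n$ into parts congruent to $0$, $1$, $3$, or $5 \pmod 6$; (ii) $C_2(n)$ is the number of partitions of $n$ satisfying all of the following: (a) if two adjacent parts differ by exactly $1$, the smaller of the two is not $\equiv 1 \pmod 3$; (b) if two adjacent parts differ by exactly $2$, the smaller of the two is $\equiv 2 \pmod 3$; (c) no part equals $2$.
   Context: A partition of $n$ is a nonincreasing sequence of positive integers $\lambda_1\ge\lambda_2\ge\cdots\ge\lambda_k\ge1$ with sum $n$. "Adjacent parts" means $\lambda_j$ and $\lambda_{j+1}$ for some $j$, when the parts are written in nonincreasing order. -}

module Defs where

open import Data.Nat using (ℕ; zero; suc; _+_; _≤_; _≥_; s≤s; _%_; _≟_; _≤?_; _≥?_)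
open import Data.Nat.ListAction using (sum)
open import Data.Nat.Properties
  using (+-identityʳ; +-suc; +-cancelˡ-≡; +-monoˡ-≤; m<m+n; m≤m+n; ≤-refl; ≤-trans;
         <⇒≤; <⇒≢; <-irrefl; <-≤-trans; m≤n⇒m<n∨m≡n)
open import Data.List using (List; []; _∷_; _++_; map; filter; length)
open import Data.List.Membership.Propositional using (_∈_)
open import Data.List.Membership.Propositional.Properties
  using (∈-map⁺; ∈-map⁻; ∈-++⁺ˡ; ∈-++⁺ʳ; ∈-++⁻; ∈-filter⁺; ∈-filter⁻)
open import Data.List.Properties using (∷-injectiveʳ)
open import Data.List.Relation.Binary.Disjoint.Propositional using (Disjoint)
open import Data.List.Relation.Unary.All using (All; []; _∷_; all?)
open import Data.List.Relation.Unary.AllPairs using ([]; _∷_)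
open import Data.List.Relation.Unary.Any using (here)
open import Data.List.Relation.Unary.Linked using (Linked; linked?)
open import Data.List.Relation.Unary.Unique.Propositional using (Unique)
import Data.List.Relation.Unary.Unique.Propositional.Properties as Unique
open import Data.Product using (_×_; _,_; proj₂; ∃₂)
open import Data.Sum using (_⊎_; inj₁; inj₂)
open import Function using (_∘′_; _⇔_; mk⇔)
open import Level using (0ℓ)
open import Relation.Binary.Definitions using () renaming (Decidable to Decidable₂)
open import Relation.Binary.PropositionalEquality using (_≡_; _≢_; refl; sym; trans; cong)
open import Relation.Nullary using (contradiction)
open import Relation.Nullary.Decidable using (¬?; _×-dec_; _⊎-dec_; _→-dec_)
open import Relation.Unary using (Pred; Decidable)

IsPartition : ℕ → Pred (List ℕ) 0ℓ
IsPartition n λs = Linked _≥_ λs × All (1 ≤_) λs × sum λs ≡ n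

isPartition? : ∀ n → Decidable (IsPartition n)
isPartition? n λs = linked? _≥?_ λs ×-dec all? (1 ≤?_) λs ×-dec sum λs ≟ n

-- The sequences of positive integers with sum a + n and first term at least a
-- (for a ≥ 1).
compositionsFrom : ℕ → ℕ → List (List ℕ)
compositionsFrom a zero    = (a ∷ []) ∷ []
compositionsFrom a (suc n) =
  map (a ∷_) (compositionsFrom 1 n) ++ compositionsFrom (suc a) n

compositions : ℕ → List (List ℕ)
compositions zero    = [] ∷ []
compositions (suc n) = compositionsFrom 1 n

-- By ∈-partitions and partitions-unique below, this lists every partition of n
-- exactly once.
partitions : ℕ → List (List ℕ)
partitions n = filter (isPartition? n) (compositions n)

count : ∀ {ℓ} {P : Pred (List ℕ) ℓ} → Decidable P → ℕ → ℕ
count P? n = length (filter P? (partitions n))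

PartsMod6 : Pred (List ℕ) 0ℓ
PartsMod6 = All (λ p → p % 6 ≡ 0 ⊎ p % 6 ≡ 1 ⊎ p % 6 ≡ 3 ⊎ p % 6 ≡ 5)

partsMod6? : Decidable PartsMod6
partsMod6? = all? λ p → p % 6 ≟ 0 ⊎-dec p % 6 ≟ 1 ⊎-dec p % 6 ≟ 3 ⊎-dec p % 6 ≟ 5

-- For adjacent parts p ≥ q, so that q is the smaller one.
AdjacentOK : ℕ → ℕ → Set
AdjacentOK p q = (p ≡ q + 1 → q % 3 ≢ 1) × (p ≡ q + 2 → q % 3 ≡ 2)

adjacentOK? : Decidable₂ AdjacentOK
adjacentOK? p q =
  (p ≟ q + 1 →-dec ¬? (q % 3 ≟ 1)) ×-dec (p ≟ q + 2 →-dec q % 3 ≟ 2)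

GapConditions : Pred (List ℕ) 0ℓ
GapConditions λs = Linked AdjacentOK λs × All (_≢ 2) λs

gapConditions? : Decidable GapConditions
gapConditions? λs = linked? adjacentOK? λs ×-dec all? (λ p → ¬? (p ≟ 2)) λs

C₁ C₂ : ℕ → ℕ
C₁ = count partsMod6?
C₂ = count gapConditions?

private
  from-complete : ∀ a n {x xs} → a ≤ x → All (1 ≤_) xs → x + sum xs ≡ a + n →
                  (x ∷ xs) ∈ compositionsFrom a n
  from-complete a zero {x} {[]} a≤x [] eq
    rewrite +-identityʳ x | +-identityʳ a = here (cong (_∷ []) eq)
  from-complete a zero {x} {y ∷ ys} a≤x (1≤y ∷ _) eq =
    contradiction (trans eq (+-identityʳ a))
      (<⇒≢ (<-≤-trans (m<m+n a (≤-trans 1≤y (m≤m+n y (sum ys))))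
                      (+-monoˡ-≤ (y + sum ys) a≤x)) ∘′ sym)
  from-complete a (suc n) {x} {xs} a≤x pos eq with m≤n⇒m<n∨m≡n a≤x
  ... | inj₁ a<x = ∈-++⁺ʳ (map (a ∷_) (compositionsFrom 1 n))
                     (from-complete (suc a) n a<x pos (trans eq (+-suc a n)))
  ... | inj₂ refl with xs | pos | +-cancelˡ-≡ a (sum xs) (suc n) eq
  ...   | y ∷ ys | 1≤y ∷ pos′ | eq′ =
          ∈-++⁺ˡ (∈-map⁺ (a ∷_) (from-complete 1 n 1≤y pos′ eq′))

  from-head : ∀ a n {xs} → xs ∈ compositionsFrom a n →
              ∃₂ λ y ys → xs ≡ y ∷ ys × a ≤ y
  from-head a zero    (here refl) = a , [] , refl , ≤-refl
  from-head a (suc n) xs∈ with ∈-++⁻ (map (a ∷_) (compositionsFrom 1 n)) xs∈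
  ... | inj₁ p with _ , _ , refl ← ∈-map⁻ (a ∷_) p = a , _ , refl , ≤-refl
  ... | inj₂ p with y , ys , eq , a<y ← from-head (suc a) n p =
          y , ys , eq , <⇒≤ a<y

  from-unique : ∀ a n → Unique (compositionsFrom a n)
  from-unique a zero    = [] ∷ []
  from-unique a (suc n) =
    Unique.++⁺ (Unique.map⁺ ∷-injectiveʳ (from-unique 1 n))
               (from-unique (suc a) n) disjoint
    where
    disjoint : Disjoint (map (a ∷_) (compositionsFrom 1 n)) (compositionsFrom (suc a) n)
    disjoint (p , q) with ∈-map⁻ (a ∷_) p | from-head (suc a) n q
    ... | _ , _ , refl | _ , _ , refl , a<a = <-irrefl refl a<a

  compositions-complete : ∀ n {xs} → All (1 ≤_) xs → sum xs ≡ n → xs ∈ compositions n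
  compositions-complete zero    []              _  = here refl
  compositions-complete zero    (s≤s _ ∷ _)     ()
  compositions-complete (suc n) (1≤x ∷ pos)     eq = from-complete 1 n 1≤x pos eq

  compositions-unique : ∀ n → Unique (compositions n)
  compositions-unique zero    = [] ∷ []
  compositions-unique (suc n) = from-unique 1 n

∈-partitions : ∀ n {λs} → λs ∈ partitions n ⇔ IsPartition n λs
∈-partitions n = mk⇔
  (λ λs∈ → proj₂ (∈-filter⁻ (isPartition? n) {xs = compositions n} λs∈))
  (λ p@(_ , pos , eq) → ∈-filter⁺ (isPartition? n) (compositions-complete n pos eq) p)

partitions-unique : ∀ n → Unique (partitions n)
partitions-unique n = Unique.filter⁺ (isPartition? n) (compositions-unique n)

-- As 2 is no part, two distinct parts exclude each other exactly when they are neighbours in the sequence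
-- 1, 3, 5, 4, 6, 8, 7, 9, 11, ..., in which every third term increases by 3.  Hence C₂ is counted
-- by the continuant of the weights q^p / (1 - q^p) along this sequence.  Let κ(a, b, c) be the
-- continuant along a, b, c, a + 3, b + 3, c + 3, ....  Contracting three steps of the continuant
-- recursion gives, for (1 - q^a) κ(a, c + 3, e), a second-order recursion in the shift by 3 whose
-- coefficients are symmetric in a and c; therefore
--   (1 - q^a) κ(a, c + 3, e) = (1 - q^c) κ(c, a + 3, e).
-- At c = 0 the part c is forced to occur and excludes its neighbour a + 3, so that the right-hand
-- side becomes κ(e, 3, a + 6).  Iterating from κ(1, 3, 5) splits off 1 / (1 - q^p) for all
-- p ≡ 1, 5 (mod 6), and the multiples of 3 remain unconstrained.

module Submission where

open import Defs
open import Algebra using (CommutativeRing)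
import Algebra.Properties.Group as GroupProperties
import Algebra.Properties.Semiring.Exp as Exp
import Algebra.Solver.Ring.NaturalCoefficients.Default as SemiringSolver
open import Data.Integer as ℤ using (ℤ; +_)
import Data.Integer.Properties as ℤ
open import Data.Integer.Solver using (module +-*-Solver)
open import Data.List using (List; []; _∷_; _++_; map; filter; length; head)
open import Data.List.Membership.Propositional using (_∈_)
open import Data.List.Membership.Propositional.Properties
  using (∈-map⁺; ∈-map⁻; ∈-++⁺ˡ; ∈-++⁺ʳ; ∈-++⁻; ∈-filter⁺; ∈-filter⁻)
open import Data.List.Membership.Propositional.Properties.WithK using (unique∧set⇒bag)
open import Data.List.Properties using (∷-injectiveʳ; length-++; length-map)
open import Data.List.Relation.Binary.BagAndSetEquality using (∼bag⇒↭)
open import Data.List.Relation.Binary.Permutation.Propositional.Properties using (↭-length)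
open import Data.List.Relation.Unary.All as All using (All; []; _∷_; all?)
open import Data.List.Relation.Unary.AllPairs using ([])
open import Data.List.Relation.Unary.Linked as Linked using (Linked; [-]; _∷_; linked?)
open import Data.List.Relation.Unary.Unique.Propositional using (Unique)
import Data.List.Relation.Unary.Unique.Propositional.Properties as Unique
open import Data.Maybe.Relation.Unary.All as Maybe using (just; nothing)
open import Data.Nat
  using (ℕ; zero; suc; _+_; _*_; _%_; _≤_; _≥_; _<_; _≟_; _≤?_; _<?_; _≥?_; z≤n; s≤s; s<s; NonZero)
open import Data.Nat.DivMod using ([m+kn]%n≡m%n)
open import Data.Nat.ListAction using (sum)
import Data.Nat.Properties as ℕ
open import Data.Nat.Tactic.RingSolver using (solve-∀)
open import Algebra.Properties.CommutativeSemigroup ℕ.+-commutativeSemigroup using (xy∙z≈y∙xz)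
open import Data.Product using (_×_; _,_; proj₁; proj₂; ∃-syntax)
open import Data.Sum using (_⊎_; inj₁; inj₂)
open import Function using (_∘_; id; _⇔_; mk⇔; Equivalence)
open import Level using (0ℓ)
open import Relation.Binary.Core using (Rel)
open import Relation.Binary.Definitions using () renaming (Decidable to Decidable₂)
open import Relation.Binary.PropositionalEquality
  using (_≡_; _≢_; _≗_; refl; sym; trans; cong; cong₂; subst)
open import Relation.Nullary using (¬_; contradiction; yes; no)
open import Relation.Nullary.Decidable using (_×-dec_; _⊎-dec_; ¬?)
open import Relation.Unary using (Pred; Decidable)

-- Continuants along three interleaved progressions of step 3.

path : ℕ → ℕ → ℕ → ℕ → ℕ
path a b c zero    = a
path a b c (suc i) = path b c (3 + a) i

path-*3 : ∀ a b c t → path a b c (t * 3) ≡ a + t * 3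
path-*3 a b c zero    = sym (ℕ.+-identityʳ a)
path-*3 a b c (suc t) = trans (path-*3 (3 + a) (3 + b) (3 + c) t) (xy∙z≈y∙xz 3 a (t * 3))

-- Nilpotency of `q` replaces convergence: for e ≥ 1 the inverse of 1 - q^e is a finite geometric
-- sum, and parts from `N` on have weight 0, so that infinite continuants and products become
-- finite.
module Continuant {r ℓ} (R : CommutativeRing r ℓ)
  (q : CommutativeRing.Carrier R) (N : ℕ)
  (q^N≈0 : CommutativeRing._≈_ R (Exp._^_ (CommutativeRing.semiring R) q N) (CommutativeRing.0# R))
  where

  open CommutativeRing R
    using (Carrier; _≈_; 0#; 1#; _-_; semiring; commutativeSemiring; +-group; setoid;
           +-cong; +-congˡ; +-congʳ; +-assoc; +-identityˡ; +-identityʳ; -‿inverseˡ; -‿inverseʳ;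
           *-cong; *-congˡ; *-congʳ; *-assoc; *-comm; *-identityˡ; *-identityʳ; zeroˡ)
    renaming (_+_ to infixl 6 _⊕_; _*_ to infixl 7 _⊛_;
              refl to ≈-refl; sym to ≈-sym; trans to ≈-trans)
  open Exp semiring using (_^_; ^-homo-*; ^-assocʳ; ^-congʳ)
  open GroupProperties +-group using () renaming (∙-cancelʳ to ⊕-cancelʳ)
  open SemiringSolver commutativeSemiring using (solve; con; _:=_; _:+_; _:*_)
  open import Relation.Binary.Reasoning.Setoid setoid

  q^≈0 : ∀ {m} → N ≤ m → q ^ m ≈ 0#
  q^≈0 {m} N≤m with k , refl ← ℕ.m≤n⇒∃[o]m+o≡n N≤m = begin
    q ^ (N + k)    ≈⟨ ^-homo-* q N k ⟩
    q ^ N ⊛ q ^ k  ≈⟨ *-congʳ q^N≈0 ⟩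
    0# ⊛ q ^ k     ≈⟨ zeroˡ _ ⟩
    0#             ∎

  D : ℕ → Carrier
  D e = 1# - q ^ e

  D-congʳ : ∀ {m n} → m ≡ n → D m ≈ D n
  D-congʳ refl = ≈-refl

  D+q^≈1 : ∀ e → D e ⊕ q ^ e ≈ 1#
  D+q^≈1 e = ≈-trans (+-assoc _ _ _) (≈-trans (+-congˡ (-‿inverseˡ _)) (+-identityʳ 1#))

  geometric : Carrier → ℕ → Carrier
  geometric x zero    = 0#
  geometric x (suc j) = 1# ⊕ x ⊛ geometric x j

  geometric-suc : ∀ x j → geometric x (suc j) ≈ geometric x j ⊕ x ^ j
  geometric-suc x zero    =
    solve 1 (λ x → con 1 :+ x :* con 0 := con 0 :+ con 1) ≈-refl x
  geometric-suc x (suc j) = begin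
    1# ⊕ x ⊛ geometric x (suc j)          ≈⟨ +-congˡ (*-congˡ (geometric-suc x j)) ⟩
    1# ⊕ x ⊛ (geometric x j ⊕ x ^ j)
      ≈⟨ solve 3 (λ x g y → con 1 :+ x :* (g :+ y) := (con 1 :+ x :* g) :+ x :* y) ≈-refl x _ _ ⟩
    geometric x (suc j) ⊕ x ^ suc j       ∎

  -- For e ≥ 1 these are 1 / (1 - q^e) and q^e / (1 - q^e): the part e used any number of times, and
  -- used at least once.
  Y W : ℕ → Carrier
  Y e = geometric (q ^ e) N
  W e = q ^ e ⊛ Y e

  Y-congʳ : ∀ {m n} → m ≡ n → Y m ≈ Y n
  Y-congʳ refl = ≈-refl

  W-congʳ : ∀ {m n} → m ≡ n → W m ≈ W n
  W-congʳ refl = ≈-refl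

  -- The geometric sum Y e has only N terms, which suffices modulo q^N unless e is 0.
  Y≈1+W : ∀ e .{{_ : NonZero e}} → Y e ≈ 1# ⊕ W e
  Y≈1+W e = ≈-sym (begin
    geometric (q ^ e) (suc N)  ≈⟨ geometric-suc (q ^ e) N ⟩
    Y e ⊕ (q ^ e) ^ N          ≈⟨ +-congˡ (≈-trans (^-assocʳ q e N) (q^≈0 (ℕ.m≤n*m N e))) ⟩
    Y e ⊕ 0#                   ≈⟨ +-identityʳ _ ⟩
    Y e                        ∎)

  D⊛Y≈1 : ∀ e .{{_ : NonZero e}} → D e ⊛ Y e ≈ 1#
  D⊛Y≈1 e = ⊕-cancelʳ (W e) _ _ (begin
    D e ⊛ Y e ⊕ q ^ e ⊛ Y e  ≈⟨ solve 3 (λ d x y → d :* y :+ x :* y := (d :+ x) :* y) ≈-refl _ _ _ ⟩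
    (D e ⊕ q ^ e) ⊛ Y e      ≈⟨ *-congʳ (D+q^≈1 e) ⟩
    1# ⊛ Y e                 ≈⟨ *-identityˡ _ ⟩
    Y e                      ≈⟨ Y≈1+W e ⟩
    1# ⊕ W e                 ∎)

  -- Since `D e` has the inverse `Y e`, the equation can be solved for `f`. It arises whenever a
  -- part `e` may be repeated without limit.
  Y-unique : ∀ e .{{_ : NonZero e}} {f g} → f ≈ g ⊕ q ^ e ⊛ f → f ≈ Y e ⊛ g
  Y-unique e {f} {g} eq = begin
    f                  ≈⟨ *-identityˡ f ⟨
    1# ⊛ f             ≈⟨ *-congʳ (D⊛Y≈1 e) ⟨
    D e ⊛ Y e ⊛ f      ≈⟨ solve 3 (λ d y f → d :* y :* f := y :* (d :* f)) ≈-refl _ _ _ ⟩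
    Y e ⊛ (D e ⊛ f)    ≈⟨ *-congˡ (⊕-cancelʳ (q ^ e ⊛ f) _ _ (begin
      D e ⊛ f ⊕ q ^ e ⊛ f  ≈⟨ solve 3 (λ d x f → d :* f :+ x :* f := (d :+ x) :* f) ≈-refl _ _ _ ⟩
      (D e ⊕ q ^ e) ⊛ f    ≈⟨ *-congʳ (D+q^≈1 e) ⟩
      1# ⊛ f               ≈⟨ *-identityˡ f ⟩
      f                    ≈⟨ eq ⟩
      g ⊕ q ^ e ⊛ f        ∎)) ⟩
    Y e ⊛ g            ∎

  W≈0 : ∀ {e} → N ≤ e → W e ≈ 0#
  W≈0 N≤e = ≈-trans (*-congʳ (q^≈0 N≤e)) (zeroˡ _)

  -- κ a b c m is the continuant of the first m - 1 weights along path a b c; the case m = 0 is the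
  -- value at length -1 that the recursion requires.
  κ : ℕ → ℕ → ℕ → ℕ → Carrier
  κ a b c zero          = 1#
  κ a b c (suc zero)    = 1#
  κ a b c (suc (suc m)) = κ b c (3 + a) (suc m) ⊕ W a ⊛ κ c (3 + a) (3 + b) m

  -- A continuant can be expanded from either end. The definition expands at the front, which suits
  -- the symmetry in the first terms; expansion at the back suits truncation and the insertion of
  -- new parts along the path.
  κ-snoc : ∀ a b c m → κ a b c (2 + m) ≈ κ a b c (1 + m) ⊕ W (path a b c m) ⊛ κ a b c m
  κ-snoc a b c zero          = ≈-refl
  κ-snoc a b c (suc zero)    =
    solve 2 (λ x y → (con 1 :+ y :* con 1) :+ x :* con 1 := (con 1 :+ x :* con 1) :+ y :* con 1)
      ≈-refl (W a) (W b)
  κ-snoc a b c (suc (suc m)) = begin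
    κ b c (3 + a) (3 + m) ⊕ W a ⊛ κ c (3 + a) (3 + b) (2 + m)
      ≈⟨ +-cong (κ-snoc b c (3 + a) (suc m)) (*-congˡ (κ-snoc c (3 + a) (3 + b) m)) ⟩
    (κ b c (3 + a) (2 + m) ⊕ w ⊛ κ b c (3 + a) (1 + m)) ⊕
      W a ⊛ (κ c (3 + a) (3 + b) (1 + m) ⊕ w ⊛ κ c (3 + a) (3 + b) m)
      ≈⟨ solve 6 (λ p u r x s t →
            (p :+ u :* r) :+ x :* (s :+ u :* t) := (p :+ x :* s) :+ u :* (r :+ x :* t))
          ≈-refl _ w _ (W a) _ _ ⟩
    κ a b c (3 + m) ⊕ w ⊛ κ a b c (2 + m) ∎
    where w = W (path c (3 + a) (3 + b) m)

  -- (1 - q^a) κ a (3 + c) e (2 + m), in a form that makes sense for a = 0.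
  H : ℕ → ℕ → ℕ → ℕ → Carrier
  H m a c e = D a ⊛ κ (3 + c) e (3 + a) (1 + m) ⊕ q ^ a ⊛ κ e (3 + a) (6 + c) m

  -- `D a ⊛ W a` is q^a, so multiplying the first step of the recursion by `D a` clears its
  -- denominator and yields `H`; the factor `Y a` undoes this.
  κ≈Y⊛H : ∀ m a c e .{{_ : NonZero a}} → κ a (3 + c) e (2 + m) ≈ Y a ⊛ H m a c e
  κ≈Y⊛H m a c e = ≈-sym (begin
    Y a ⊛ (D a ⊛ u ⊕ q ^ a ⊛ v)
      ≈⟨ solve 5 (λ y d x u v → y :* (d :* u :+ x :* v) := (d :* y) :* u :+ x :* y :* v) ≈-refl _ _ _ _ _ ⟩
    D a ⊛ Y a ⊛ u ⊕ W a ⊛ v  ≈⟨ +-congʳ (≈-trans (*-congʳ (D⊛Y≈1 a)) (*-identityˡ u)) ⟩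
    u ⊕ W a ⊛ v ∎)
    where
    u = κ (3 + c) e (3 + a) (1 + m)
    v = κ e (3 + a) (6 + c) m

  -- In fractions, with x = q^a and z = q^(3 + c): 1 + (1 - x) z / (1 - z) = (1 - x z) / (1 - z).
  -- Adding x z / (1 - z) to both sides removes the subtractions. The new numerator is symmetric in
  -- `a` and `c`.
  1+D⊛W : ∀ a c → 1# ⊕ D a ⊛ W (3 + c) ≈ Y (3 + c) ⊛ D (3 + (a + c))
  1+D⊛W a c = ⊕-cancelʳ (q ^ a ⊛ W (3 + c)) _ _ (begin
    (1# ⊕ D a ⊛ W (3 + c)) ⊕ q ^ a ⊛ W (3 + c)
      ≈⟨ solve 3 (λ d x w → (con 1 :+ d :* w) :+ x :* w := con 1 :+ (d :+ x) :* w) ≈-refl _ _ _ ⟩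
    1# ⊕ (D a ⊕ q ^ a) ⊛ W (3 + c)
      ≈⟨ +-congˡ (≈-trans (*-congʳ (D+q^≈1 a)) (*-identityˡ _)) ⟩
    1# ⊕ W (3 + c)  ≈⟨ Y≈1+W (3 + c) ⟨
    Y (3 + c)  ≈⟨ *-identityʳ _ ⟨
    Y (3 + c) ⊛ 1#  ≈⟨ *-congˡ (D+q^≈1 (3 + (a + c))) ⟨
    Y (3 + c) ⊛ (D (3 + (a + c)) ⊕ q ^ (3 + (a + c)))
      ≈⟨ *-congˡ (+-congˡ (*-congˡ (*-congˡ (*-congˡ (^-homo-* q a c))))) ⟩
    Y (3 + c) ⊛ (D (3 + (a + c)) ⊕ q ⊛ (q ⊛ (q ⊛ (q ^ a ⊛ q ^ c))))
      ≈⟨ solve 5 (λ y d q x z →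
            y :* (d :+ q :* (q :* (q :* (x :* z)))) := y :* d :+ x :* (q :* (q :* (q :* z)) :* y))
          ≈-refl _ _ _ _ _ ⟩
    Y (3 + c) ⊛ D (3 + (a + c)) ⊕ q ^ a ⊛ W (3 + c) ∎)

  -- Both continuants in `H` unfold to combinations of `u` and `v`. Because D a + q^a = 1, the
  -- coefficient of `v` becomes `W e`, and that of `u` is evaluated by `1+D⊛W`.
  H-unfold : ∀ m a c e → H (3 + m) a c e ≈
    Y (3 + c) ⊛ D (3 + (a + c)) ⊛ κ (3 + a) (6 + c) (3 + e) (2 + m) ⊕
    W e ⊛ κ (6 + c) (3 + e) (6 + a) (1 + m)
  H-unfold m a c e = begin
    D a ⊛ ((u ⊕ W e ⊛ v) ⊕ W (3 + c) ⊛ u) ⊕ q ^ a ⊛ (u ⊕ W e ⊛ v)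
      ≈⟨ solve 6 (λ d x u w z v →
            d :* ((u :+ w :* v) :+ z :* u) :+ x :* (u :+ w :* v) :=
            (d :+ x) :* (u :+ w :* v) :+ d :* z :* u) ≈-refl _ _ _ _ _ _ ⟩
    (D a ⊕ q ^ a) ⊛ (u ⊕ W e ⊛ v) ⊕ D a ⊛ W (3 + c) ⊛ u
      ≈⟨ +-congʳ (*-congʳ (D+q^≈1 a)) ⟩
    1# ⊛ (u ⊕ W e ⊛ v) ⊕ D a ⊛ W (3 + c) ⊛ u
      ≈⟨ solve 4 (λ u w v z → con 1 :* (u :+ w :* v) :+ z :* u := (con 1 :+ z) :* u :+ w :* v) ≈-refl _ _ _ _ ⟩
    (1# ⊕ D a ⊛ W (3 + c)) ⊛ u ⊕ W e ⊛ v
      ≈⟨ +-congʳ (*-congʳ (1+D⊛W a c)) ⟩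
    Y (3 + c) ⊛ D (3 + (a + c)) ⊛ u ⊕ W e ⊛ v ∎
    where
    u = κ (3 + a) (6 + c) (3 + e) (2 + m)
    v = κ (6 + c) (3 + e) (6 + a) (1 + m)

  -- In `H-unfold`, the first continuant is a multiple of `H′` by `κ≈Y⊛H`, and `φ₄-eq` expresses the
  -- second by `H′` and `H″`. The factors for 3 + c and 3 + a, and those for 6 + c and 6 + a, now
  -- occur in pairs, so all coefficients are symmetric in `a` and `c`.
  H-recurrence : ∀ m a c e → H (6 + m) a c e ≈
    (Y (3 + c) ⊛ Y (3 + a) ⊛ D (3 + (a + c)) ⊕ W e) ⊛ H (3 + m) (3 + a) (3 + c) (3 + e) ⊕
    W e ⊛ q ^ (9 + (a + c)) ⊛ (Y (6 + c) ⊛ Y (6 + a)) ⊛ H m (6 + a) (6 + c) (6 + e)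
  H-recurrence m a c e = begin
    H (6 + m) a c e
      ≈⟨ H-unfold (3 + m) a c e ⟩
    Y (3 + c) ⊛ D (3 + (a + c)) ⊛ κ (3 + a) (6 + c) (3 + e) (5 + m) ⊕ W e ⊛ φ₄
      ≈⟨ +-cong (*-congˡ (κ≈Y⊛H (3 + m) (3 + a) (3 + c) (3 + e))) (*-congˡ φ₄-eq) ⟩
    Y (3 + c) ⊛ D (3 + (a + c)) ⊛ (Y (3 + a) ⊛ H′) ⊕
      W e ⊛ (H′ ⊕ q ^ (9 + (a + c)) ⊛ (Y (6 + c) ⊛ Y (6 + a)) ⊛ H″)
      ≈⟨ solve 8 (λ y d z h w x u k →
            y :* d :* (z :* h) :+ w :* (h :+ x :* u :* k) :=
            (y :* z :* d :+ w) :* h :+ w :* x :* u :* k) ≈-refl _ _ _ _ _ _ _ _ ⟩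
    (Y (3 + c) ⊛ Y (3 + a) ⊛ D (3 + (a + c)) ⊕ W e) ⊛ H′ ⊕
      W e ⊛ q ^ (9 + (a + c)) ⊛ (Y (6 + c) ⊛ Y (6 + a)) ⊛ H″ ∎
    where
    H′ = H (3 + m) (3 + a) (3 + c) (3 + e)
    H″ = H m (6 + a) (6 + c) (6 + e)
    φ₄ = κ (6 + c) (3 + e) (6 + a) (4 + m)
    φ₅ = κ (3 + e) (6 + a) (9 + c) (3 + m)
    φ₆ = κ (6 + a) (9 + c) (6 + e) (2 + m)

    powers : q ^ (3 + a) ⊛ q ^ (6 + c) ≈ q ^ (9 + (a + c))
    powers = ≈-trans (≈-sym (^-homo-* q (3 + a) (6 + c)))
      (^-congʳ q (cong (_+_ 3) (sym (xy∙z≈y∙xz 6 a c))))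

    -- `H′` is `D (3 + a) ⊛ φ₄ ⊕ q ^ (3 + a) ⊛ φ₅`, so φ₄ - H′ = q^(3 + a) (φ₄ - φ₅). The recursion
    -- gives φ₄ - φ₅ as `W (6 + c) ⊛ φ₆`, and `φ₆` is `Y (6 + a) ⊛ H″`.
    φ₄-eq : φ₄ ≈ H′ ⊕ q ^ (9 + (a + c)) ⊛ (Y (6 + c) ⊛ Y (6 + a)) ⊛ H″
    φ₄-eq = begin
      φ₄                                                  ≈⟨ *-identityˡ φ₄ ⟨
      1# ⊛ φ₄                                             ≈⟨ *-congʳ (D+q^≈1 (3 + a)) ⟨
      (D (3 + a) ⊕ q ^ (3 + a)) ⊛ (φ₅ ⊕ W (6 + c) ⊛ φ₆)
        ≈⟨ solve 6 (λ d x f y k g →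
              (d :+ x) :* (f :+ y :* k :* g) :=
              (d :* (f :+ y :* k :* g) :+ x :* f) :+ (x :* y) :* (k :* g)) ≈-refl _ _ _ _ _ _ ⟩
      H′ ⊕ q ^ (3 + a) ⊛ q ^ (6 + c) ⊛ (Y (6 + c) ⊛ φ₆)
        ≈⟨ +-congˡ (*-cong powers (*-congˡ (κ≈Y⊛H m (6 + a) (6 + c) (6 + e)))) ⟩
      H′ ⊕ q ^ (9 + (a + c)) ⊛ (Y (6 + c) ⊛ (Y (6 + a) ⊛ H″))
        ≈⟨ +-congˡ (solve 4 (λ x y z h → x :* (y :* (z :* h)) := x :* (y :* z) :* h) ≈-refl _ _ _ _) ⟩
      H′ ⊕ q ^ (9 + (a + c)) ⊛ (Y (6 + c) ⊛ Y (6 + a)) ⊛ H″ ∎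

  -- Induction of order two along `H-recurrence`, whose coefficients survive the exchange of `a` and
  -- `c`. A length divisible by 3 leads down to `H 0` and `H 3`; the former is 1 thanks to the value
  -- of `κ` at length -1.
  H-sym : ∀ t a c e → H (t * 3) a c e ≈ H (t * 3) c a e
  H-sym zero a c e = ≈-trans (H₀ a) (≈-sym (H₀ c))
    where
    H₀ : ∀ a → D a ⊛ 1# ⊕ q ^ a ⊛ 1# ≈ 1#
    H₀ a = ≈-trans (+-cong (*-identityʳ _) (*-identityʳ _)) (D+q^≈1 a)
  H-sym (suc zero) a c e = begin
    H 3 a c e                                                ≈⟨ H₃ a c ⟩
    Y (3 + c) ⊛ Y (3 + a) ⊛ D (3 + (a + c)) ⊕ W e ⊛ 1#
      ≈⟨ +-congʳ (*-cong (*-comm _ _) (D-congʳ (cong (_+_ 3) (ℕ.+-comm a c)))) ⟩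
    Y (3 + a) ⊛ Y (3 + c) ⊛ D (3 + (c + a)) ⊕ W e ⊛ 1#       ≈⟨ H₃ c a ⟨
    H 3 c a e                                                ∎
    where
    H₃ : ∀ a c → H 3 a c e ≈ Y (3 + c) ⊛ Y (3 + a) ⊛ D (3 + (a + c)) ⊕ W e ⊛ 1#
    H₃ a c = begin
      H 3 a c e  ≈⟨ H-unfold 0 a c e ⟩
      Y (3 + c) ⊛ D (3 + (a + c)) ⊛ (1# ⊕ W (3 + a) ⊛ 1#) ⊕ W e ⊛ 1#
        ≈⟨ +-congʳ (*-congˡ (≈-trans (+-congˡ (*-identityʳ _)) (≈-sym (Y≈1+W (3 + a))))) ⟩
      Y (3 + c) ⊛ D (3 + (a + c)) ⊛ Y (3 + a) ⊕ W e ⊛ 1#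
        ≈⟨ +-congʳ (solve 3 (λ y d z → y :* d :* z := y :* z :* d) ≈-refl _ _ _) ⟩
      Y (3 + c) ⊛ Y (3 + a) ⊛ D (3 + (a + c)) ⊕ W e ⊛ 1# ∎
  H-sym (suc (suc t)) a c e = begin
    H (6 + t * 3) a c e
      ≈⟨ H-recurrence (t * 3) a c e ⟩
    (Y (3 + c) ⊛ Y (3 + a) ⊛ D (3 + (a + c)) ⊕ W e) ⊛ H (3 + t * 3) (3 + a) (3 + c) (3 + e) ⊕
      W e ⊛ q ^ (9 + (a + c)) ⊛ (Y (6 + c) ⊛ Y (6 + a)) ⊛ H (t * 3) (6 + a) (6 + c) (6 + e)
      ≈⟨ +-cong
           (*-cong (+-congʳ (*-cong (*-comm _ _) (D-congʳ 3+))) (H-sym (suc t) (3 + a) (3 + c) (3 + e)))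
           (*-cong (*-cong (*-congˡ (^-congʳ q 9+)) (*-comm _ _)) (H-sym t (6 + a) (6 + c) (6 + e))) ⟩
    (Y (3 + a) ⊛ Y (3 + c) ⊛ D (3 + (c + a)) ⊕ W e) ⊛ H (3 + t * 3) (3 + c) (3 + a) (3 + e) ⊕
      W e ⊛ q ^ (9 + (c + a)) ⊛ (Y (6 + a) ⊛ Y (6 + c)) ⊛ H (t * 3) (6 + c) (6 + a) (6 + e)
      ≈⟨ H-recurrence (t * 3) c a e ⟨
    H (6 + t * 3) c a e ∎
    where
    3+ = cong (_+_ 3) (ℕ.+-comm a c)
    9+ = cong (_+_ 9) (ℕ.+-comm a c)

  drop-last : ∀ a b c m → N ≤ path a b c m → κ a b c (2 + m) ≈ κ a b c (1 + m)
  drop-last a b c m N≤ = begin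
    κ a b c (2 + m)                                    ≈⟨ κ-snoc a b c m ⟩
    κ a b c (1 + m) ⊕ W (path a b c m) ⊛ κ a b c m     ≈⟨ +-congˡ (≈-trans (*-congʳ (W≈0 N≤)) (zeroˡ _)) ⟩
    κ a b c (1 + m) ⊕ 0#                               ≈⟨ +-identityʳ _ ⟩
    κ a b c (1 + m)                                    ∎

  N≤path : ∀ a b c t → N ≤ a + t * 3 → N ≤ path a b c (t * 3)
  N≤path a b c t = subst (N ≤_) (sym (path-*3 a b c t))

  -- `H-sym` with c = 0 moves `a` out of the first place and 0 into it. There `D 0` vanishes and
  -- `q ^ 0` is 1, so only the second continuant of `H` remains.
  peel : ∀ t a e .{{_ : NonZero a}} → N ≤ 3 + t * 3 →
         κ a 3 e (5 + t * 3) ≈ Y a ⊛ κ e 3 (6 + a) (2 + t * 3)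
  peel t a e N≤ = begin
    κ a 3 e (5 + t * 3)                ≈⟨ κ≈Y⊛H (3 + t * 3) a 0 e ⟩
    Y a ⊛ H (suc t * 3) a 0 e          ≈⟨ *-congˡ (H-sym (suc t) a 0 e) ⟩
    Y a ⊛ H (suc t * 3) 0 a e
      ≈⟨ *-congˡ (+-cong (≈-trans (*-congʳ (-‿inverseʳ 1#)) (zeroˡ _)) (*-identityˡ _)) ⟩
    Y a ⊛ (0# ⊕ κ e 3 (6 + a) (3 + t * 3))
      ≈⟨ *-congˡ (+-identityˡ _) ⟩
    Y a ⊛ κ e 3 (6 + a) (3 + t * 3)
      -- The term dropped is the part 3 + t * 3, of weight 0 because it is at least `N`. The length
      -- is then again 2 modulo 3, as the next peel requires.
      ≈⟨ *-congˡ (drop-last e 3 (6 + a) (1 + t * 3) (N≤path 3 (6 + a) (3 + e) t N≤)) ⟩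
    Y a ⊛ κ e 3 (6 + a) (2 + t * 3)    ∎

  Π₁₅ : ℕ → Carrier
  Π₁₅ zero    = 1#
  Π₁₅ (suc r) = Π₁₅ r ⊛ (Y (1 + r * 6) ⊛ Y (5 + r * 6))

  Π₃ : ℕ → Carrier
  Π₃ zero    = 1#
  Π₃ (suc t) = Y (3 + t * 3) ⊛ Π₃ t

  -- Two peels restore the initial shape: a, 3, e becomes e, 3, 6 + a and then 6 + a, 3, 6 + e. Each
  -- shortens the continuant by 3, so a round costs 6.
  peel-all : ∀ r t → N ≤ 3 + t * 3 →
             κ 1 3 5 (2 + (r * 6 + t * 3)) ≈ Π₁₅ r ⊛ κ (1 + r * 6) 3 (5 + r * 6) (2 + t * 3)
  peel-all zero    t N≤ = ≈-sym (*-identityˡ _)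
  peel-all (suc r) t N≤ = begin
    κ 1 3 5 (2 + (6 + r * 6 + t * 3))
      ≈⟨ κ-congʳ (cong (_+_ 2) (xy∙z≈y∙xz 6 (r * 6) (t * 3))) ⟩
    κ 1 3 5 (2 + (r * 6 + (2 + t) * 3))
      ≈⟨ peel-all r (2 + t) (ℕ.m≤n⇒m≤o+n 6 N≤) ⟩
    Π₁₅ r ⊛ κ a 3 e (2 + (2 + t) * 3)
      ≈⟨ *-congˡ (peel (suc t) a e (ℕ.m≤n⇒m≤o+n 3 N≤)) ⟩
    Π₁₅ r ⊛ (Y a ⊛ κ e 3 (6 + a) (5 + t * 3))
      ≈⟨ *-congˡ (*-congˡ (peel t e (6 + a) N≤)) ⟩
    Π₁₅ r ⊛ (Y a ⊛ (Y e ⊛ κ (6 + a) 3 (6 + e) (2 + t * 3)))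
      ≈⟨ solve 4 (λ p x y k → p :* (x :* (y :* k)) := p :* (x :* y) :* k) ≈-refl _ _ _ _ ⟩
    Π₁₅ (suc r) ⊛ κ (6 + a) 3 (6 + e) (2 + t * 3) ∎
    where
    a = 1 + r * 6
    e = 5 + r * 6
    κ-congʳ : ∀ {m n} → m ≡ n → κ 1 3 5 m ≈ κ 1 3 5 n
    κ-congʳ refl = ≈-refl

  -- Only the multiples of 3 keep a nonzero weight. They are never adjacent in the path, so each
  -- contributes its factor 1 + W = Y independently.
  κ≈Π₃ : ∀ t a e → N ≤ a → N ≤ e → κ a 3 e (2 + t * 3) ≈ Π₃ t
  κ≈Π₃ zero    a e N≤a N≤e = drop-last a 3 e 0 N≤a
  κ≈Π₃ (suc t) a e N≤a N≤e = begin
    κ a 3 e (5 + t * 3)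
      ≈⟨ drop-last a 3 e (3 + t * 3) (N≤path (3 + a) 6 (3 + e) t (≤+ (ℕ.m≤n⇒m≤o+n 3 N≤a))) ⟩
    κ a 3 e (4 + t * 3)
      ≈⟨ drop-last a 3 e (2 + t * 3) (N≤path e (3 + a) 6 t (≤+ N≤e)) ⟩
    κ a 3 e (3 + t * 3)
      ≈⟨ κ-snoc a 3 e (1 + t * 3) ⟩
    κ a 3 e (2 + t * 3) ⊕ W (path 3 e (3 + a) (t * 3)) ⊛ κ a 3 e (1 + t * 3)
      -- In the second continuant the term a + t * 3, of weight 0, is put back, so that both
      -- summands share a factor.
      ≈⟨ +-congˡ (*-cong (W-congʳ (path-*3 3 e (3 + a) t))
           (≈-sym (drop-last a 3 e (t * 3) (N≤path a 3 e t (≤+ N≤a))))) ⟩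
    κ a 3 e (2 + t * 3) ⊕ W (3 + t * 3) ⊛ κ a 3 e (2 + t * 3)
      ≈⟨ solve 2 (λ k w → k :+ w :* k := (con 1 :+ w) :* k) ≈-refl _ _ ⟩
    (1# ⊕ W (3 + t * 3)) ⊛ κ a 3 e (2 + t * 3)
      ≈⟨ *-cong (≈-sym (Y≈1+W (3 + t * 3))) (κ≈Π₃ t a e N≤a N≤e) ⟩
    Π₃ (suc t) ∎
    where
    ≤+ : ∀ {m} → N ≤ m → N ≤ m + t * 3
    ≤+ = ℕ.m≤n⇒m≤n+o (t * 3)

  -- The length provides 6 r for the rounds of peeling, which push both outer progressions past `N`,
  -- and another 6 r for the multiples of 3 up to 6 r.
  κ-product : ∀ r → N ≤ r * 6 → κ 1 3 5 (2 + r * 4 * 3) ≈ Π₁₅ r ⊛ Π₃ (r * 2)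
  κ-product r N≤ = begin
    κ 1 3 5 (2 + r * 4 * 3)             ≡⟨ cong (λ m → κ 1 3 5 (2 + m)) (length-eq r) ⟩
    κ 1 3 5 (2 + (r * 6 + r * 2 * 3))
      ≈⟨ peel-all r (r * 2) (ℕ.m≤n⇒m≤o+n 3 (subst (N ≤_) (sym (ℕ.*-assoc r 2 3)) N≤)) ⟩
    Π₁₅ r ⊛ κ (1 + r * 6) 3 (5 + r * 6) (2 + r * 2 * 3)
      ≈⟨ *-congˡ (κ≈Π₃ (r * 2) _ _ (ℕ.m≤n⇒m≤o+n 1 N≤) (ℕ.m≤n⇒m≤o+n 5 N≤)) ⟩
    Π₁₅ r ⊛ Π₃ (r * 2)                  ∎
    where
    length-eq : ∀ r → r * 4 * 3 ≡ r * 6 + r * 2 * 3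
    length-eq = solve-∀

-- Power series over the integers, truncated at q^N.

Series : Set
Series = ℕ → ℤ

infixl 6 _⊕_
infixl 7 _⊛_

-- The Cauchy product, read off from f = f(0) + X (f ∘ suc). Recursion on the index with a varying
-- first factor lets the ring laws follow by induction, without finite sums.
_⊕_ _⊛_ : Series → Series → Series
(f ⊕ g) n = f n ℤ.+ g n
(f ⊛ g) zero    = f 0 ℤ.* g 0
(f ⊛ g) (suc n) = f 0 ℤ.* g (suc n) ℤ.+ (f ∘ suc ⊛ g) n

0ₛ 1ₛ X : Series
0ₛ n = + 0
1ₛ zero    = + 1
1ₛ (suc n) = + 0
X zero     = + 0
X (suc n)  = 1ₛ n

-- A coefficient of a product involves no later coefficients of the factors; hence products respect
-- equality modulo q^N.
⊛-cong : ∀ n {f f′ g g′} → (∀ {i} → i ≤ n → f i ≡ f′ i) → (∀ {i} → i ≤ n → g i ≡ g′ i) →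
         (f ⊛ g) n ≡ (f′ ⊛ g′) n
⊛-cong zero    f≡ g≡ = cong₂ ℤ._*_ (f≡ z≤n) (g≡ z≤n)
⊛-cong (suc n) f≡ g≡ =
  cong₂ ℤ._+_ (cong₂ ℤ._*_ (f≡ z≤n) (g≡ ℕ.≤-refl))
              (⊛-cong n (f≡ ∘ s≤s) (λ i≤n → g≡ (ℕ.m≤n⇒m≤1+n i≤n)))

⊛-distribʳ : ∀ h f g → (f ⊕ g) ⊛ h ≗ (f ⊛ h) ⊕ (g ⊛ h)
⊛-distribʳ h f g zero    = ℤ.*-distribʳ-+ (h 0) (f 0) (g 0)
⊛-distribʳ h f g (suc n) = trans
  (cong (ℤ._+_ ((f 0 ℤ.+ g 0) ℤ.* h (suc n))) (⊛-distribʳ h (f ∘ suc) (g ∘ suc) n))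
  (solve 5 (λ a b c x y → (a :+ b) :* c :+ (x :+ y) := (a :* c :+ x) :+ (b :* c :+ y)) refl
    (f 0) (g 0) (h (suc n)) ((f ∘ suc ⊛ h) n) ((g ∘ suc ⊛ h) n))
  where open +-*-Solver

⊛-scale : ∀ c f g → (λ i → c ℤ.* f i) ⊛ g ≗ λ n → c ℤ.* (f ⊛ g) n
⊛-scale c f g zero    = ℤ.*-assoc c (f 0) (g 0)
⊛-scale c f g (suc n) = trans
  (cong (ℤ._+_ (c ℤ.* f 0 ℤ.* g (suc n))) (⊛-scale c (f ∘ suc) g n))
  (solve 4 (λ c a b x → c :* a :* b :+ c :* x := c :* (a :* b :+ x)) refl
    c (f 0) (g (suc n)) ((f ∘ suc ⊛ g) n))
  where open +-*-Solver

⊛-assoc : ∀ f g h → (f ⊛ g) ⊛ h ≗ f ⊛ (g ⊛ h)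
⊛-assoc f g h zero    = ℤ.*-assoc (f 0) (g 0) (h 0)
⊛-assoc f g h (suc n) = trans
  (cong (ℤ._+_ (f 0 ℤ.* g 0 ℤ.* h (suc n)))
    (trans (⊛-distribʳ h (λ i → f 0 ℤ.* g (suc i)) (f ∘ suc ⊛ g) n)
           (cong₂ ℤ._+_ (⊛-scale (f 0) (g ∘ suc) h n) (⊛-assoc (f ∘ suc) g h n))))
  (solve 5 (λ a b c x y → a :* b :* c :+ (a :* x :+ y) := a :* (b :* c :+ x) :+ y) refl
    (f 0) (g 0) (h (suc n)) ((g ∘ suc ⊛ h) n) ((f ∘ suc ⊛ (g ⊛ h)) n))
  where open +-*-Solver

-- The definition splits off the summand with `f 0`; commutativity also needs the one with `g 0`
-- split off.
⊛-last : ∀ f g n → (f ⊛ g) (suc n) ≡ (f ⊛ g ∘ suc) n ℤ.+ f (suc n) ℤ.* g 0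
⊛-last f g zero    = refl
⊛-last f g (suc n) = trans
  (cong (ℤ._+_ (f 0 ℤ.* g (2 + n))) (⊛-last (f ∘ suc) g n))
  (sym (ℤ.+-assoc (f 0 ℤ.* g (2 + n)) ((f ∘ suc ⊛ g ∘ suc) n) (f (2 + n) ℤ.* g 0)))

⊛-comm : ∀ f g → f ⊛ g ≗ g ⊛ f
⊛-comm f g zero    = ℤ.*-comm (f 0) (g 0)
⊛-comm f g (suc n) = trans (⊛-last f g n) (trans
  (ℤ.+-comm ((f ⊛ g ∘ suc) n) (f (suc n) ℤ.* g 0))
  (cong₂ ℤ._+_ (ℤ.*-comm (f (suc n)) (g 0)) (⊛-comm f (g ∘ suc) n)))

⊛-zeroˡ : ∀ f → 0ₛ ⊛ f ≗ 0ₛ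
⊛-zeroˡ f zero    = refl
⊛-zeroˡ f (suc n) = trans (ℤ.+-identityˡ _) (⊛-zeroˡ f n)

⊛-identityˡ : ∀ f → 1ₛ ⊛ f ≗ f
⊛-identityˡ f zero    = ℤ.*-identityˡ (f 0)
⊛-identityˡ f (suc n) = trans (cong₂ ℤ._+_ (ℤ.*-identityˡ (f (suc n))) (⊛-zeroˡ f n)) (ℤ.+-identityʳ _)

-- ℤ[[q]] / (q^N): equality only compares the coefficients below N.
seriesRing : ℕ → CommutativeRing 0ℓ 0ℓ
seriesRing N = record
  { Carrier = Series
  ; _≈_ = λ f g → ∀ n → n < N → f n ≡ g n
  ; _+_ = _⊕_
  ; _*_ = _⊛_
  ; -_ = λ f n → ℤ.- f n
  ; 0# = 0ₛ
  ; 1# = 1ₛ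
  ; isCommutativeRing = record
    { isRing = record
      { +-isAbelianGroup = record
        { isGroup = record
          { isMonoid = record
            { isSemigroup = record
              { isMagma = record
                { isEquivalence = record
                  { refl  = λ n _ → refl
                  ; sym   = λ f≈g n n<N → sym (f≈g n n<N)
                  ; trans = λ f≈g g≈h n n<N → trans (f≈g n n<N) (g≈h n n<N)
                  }
                ; ∙-cong = λ f≈ g≈ n n<N → cong₂ ℤ._+_ (f≈ n n<N) (g≈ n n<N)
                }
              ; assoc = λ f g h n _ → ℤ.+-assoc (f n) (g n) (h n)
              }
            ; identity = (λ f n _ → ℤ.+-identityˡ (f n)) , (λ f n _ → ℤ.+-identityʳ (f n))
            }
          ; inverse = (λ f n _ → ℤ.+-inverseˡ (f n)) , (λ f n _ → ℤ.+-inverseʳ (f n))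
          ; ⁻¹-cong = λ f≈ n n<N → cong ℤ.-_ (f≈ n n<N)
          }
        ; comm = λ f g n _ → ℤ.+-comm (f n) (g n)
        }
      ; *-cong = λ f≈ g≈ n n<N →
          ⊛-cong n (λ i≤n → f≈ _ (ℕ.≤-<-trans i≤n n<N)) (λ i≤n → g≈ _ (ℕ.≤-<-trans i≤n n<N))
      ; *-assoc = λ f g h n _ → ⊛-assoc f g h n
      ; *-identity = (λ f n _ → ⊛-identityˡ f n) , (λ f n _ → trans (⊛-comm f 1ₛ n) (⊛-identityˡ f n))
      ; distrib =
          (λ f g h n _ → trans (⊛-comm f (g ⊕ h) n)
             (trans (⊛-distribʳ f g h n) (cong₂ ℤ._+_ (⊛-comm g f n) (⊛-comm h f n))))
        , (λ f g h n _ → ⊛-distribʳ f g h n)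
      }
    ; *-comm = λ f g n _ → ⊛-comm f g n
    }
  }

module Powers (N : ℕ) where
  open Exp (CommutativeRing.semiring (seriesRing N)) public using (_^_)

  X⊛-suc : ∀ f n → (X ⊛ f) (suc n) ≡ f n
  X⊛-suc f n = trans (ℤ.+-identityˡ _) (⊛-identityˡ f n)

  X^⊛-< : ∀ p f {n} → n < p → (X ^ p ⊛ f) n ≡ + 0
  X^⊛-< (suc p) f {zero}  _         = refl
  X^⊛-< (suc p) f {suc n} (s<s n<p) =
    trans (⊛-assoc X (X ^ p) f (suc n)) (trans (X⊛-suc (X ^ p ⊛ f) n) (X^⊛-< p f n<p))

  X^⊛-+ : ∀ p f n → (X ^ p ⊛ f) (p + n) ≡ f n
  X^⊛-+ zero    f n = ⊛-identityˡ f n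
  X^⊛-+ (suc p) f n =
    trans (⊛-assoc X (X ^ p) f (suc (p + n))) (trans (X⊛-suc (X ^ p ⊛ f) (p + n)) (X^⊛-+ p f n))

  X^N≈0 : CommutativeRing._≈_ (seriesRing N) (X ^ N) 0ₛ
  X^N≈0 = vanishes N
    where
    vanishes : ∀ p n → n < p → (X ^ p) n ≡ + 0
    vanishes (suc p) zero    _         = refl
    vanishes (suc p) (suc n) (s<s n<p) = trans (X⊛-suc (X ^ p) n) (vanishes p n n<p)

-- Counting series and removal of the first part.

#_ : {P : Pred (List ℕ) 0ℓ} → Decidable P → Series
(# P?) n = + count P? n

∈-count : ∀ {P : Pred (List ℕ) 0ℓ} (P? : Decidable P) n {λs} →
          λs ∈ filter P? (partitions n) ⇔ (IsPartition n λs × P λs)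
∈-count P? n = mk⇔
  (λ λs∈ → let λs∈′ , p = ∈-filter⁻ P? {xs = partitions n} λs∈
           in Equivalence.to (∈-partitions n) λs∈′ , p)
  (λ (part , p) → ∈-filter⁺ P? (Equivalence.from (∈-partitions n) part) p)

count-unique : ∀ {P : Pred (List ℕ) 0ℓ} (P? : Decidable P) n → Unique (filter P? (partitions n))
count-unique P? n = Unique.filter⁺ P? (partitions-unique n)

unique-length : ∀ {xs ys : List (List ℕ)} → Unique xs → Unique ys →
                (∀ {z} → z ∈ xs → z ∈ ys) → (∀ {z} → z ∈ ys → z ∈ xs) → length xs ≡ length ys
unique-length u v xs⊆ys ys⊆xs = ↭-length (∼bag⇒↭ (unique∧set⇒bag u v (mk⇔ xs⊆ys ys⊆xs)))

count-cong : ∀ {P Q : Pred (List ℕ) 0ℓ} (P? : Decidable P) (Q? : Decidable Q) n →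
             (∀ {λs} → IsPartition n λs → P λs → Q λs) →
             (∀ {λs} → IsPartition n λs → Q λs → P λs) → count P? n ≡ count Q? n
count-cong P? Q? n P⇒Q Q⇒P = unique-length (count-unique P? n) (count-unique Q? n)
  (λ z∈ → let part , p = Equivalence.to (∈-count P? n) z∈
          in Equivalence.from (∈-count Q? n) (part , P⇒Q part p))
  (λ z∈ → let part , q = Equivalence.to (∈-count Q? n) z∈
          in Equivalence.from (∈-count P? n) (part , Q⇒P part q))

-- The combinatorial form of P = Q + q^p S for generating functions. `sorted` ensures that putting
-- `p` in front of a partition in `S` gives a partition again.
record _≜_⊎[_∷_] (P Q : Pred (List ℕ) 0ℓ) (p : ℕ) (S : Pred (List ℕ) 0ℓ) : Set where
  field
    split    : ∀ {λs} → P λs → Q λs ⊎ (∃[ μs ] λs ≡ p ∷ μs × S μs)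
    left     : ∀ {λs} → Q λs → P λs
    right    : ∀ {μs} → S μs → P (p ∷ μs)
    disjoint : ∀ {μs} → ¬ Q (p ∷ μs)
    sorted   : ∀ {μs} → S μs → Linked _≥_ (p ∷ μs)

module _ (N : ℕ) where
  open Powers N

  -- For n < p no partition of n starts with `p`, and the shifted series is 0. Otherwise n = p + m,
  -- and removing the first part `p` is a bijection onto the partitions of m in `S`.
  #-split : ∀ {P Q S : Pred (List ℕ) 0ℓ} {p} → P ≜ Q ⊎[ p ∷ S ] → 1 ≤ p →
            (P? : Decidable P) (Q? : Decidable Q) (S? : Decidable S) →
            ∀ n → (# P?) n ≡ (# Q? ⊕ X ^ p ⊛ # S?) n
  #-split {P} {Q} {S} {p} P≜ 1≤p P? Q? S? n with n <? p
  ... | yes n<p = trans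
    (cong +_ (count-cong P? Q? n (λ part → P⇒Q part ∘ split) (λ _ → left)))
    (sym (trans (cong (ℤ._+_ (+ count Q? n)) (X^⊛-< p (# S?) n<p)) (ℤ.+-identityʳ _)))
    where
    open _≜_⊎[_∷_] P≜
    P⇒Q : ∀ {λs} → IsPartition n λs → Q λs ⊎ (∃[ μs ] λs ≡ p ∷ μs × S μs) → Q λs
    P⇒Q _              (inj₁ q)               = q
    P⇒Q (_ , _ , refl) (inj₂ (μs , refl , _)) = contradiction (ℕ.m≤m+n p (sum μs)) (ℕ.<⇒≱ n<p)
  ... | no n≮p with m , refl ← ℕ.m≤n⇒∃[o]m+o≡n (ℕ.≮⇒≥ n≮p) = trans
    (cong +_ (trans (unique-length (count-unique P? n)
                (Unique.++⁺ (count-unique Q? n) (Unique.map⁺ ∷-injectiveʳ (count-unique S? m)) disj)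
                to from)
              (trans (length-++ (filter Q? (partitions n)))
                     (cong (_+_ (count Q? n)) (length-map (p ∷_) (filter S? (partitions m)))))))
    (cong (ℤ._+_ (+ count Q? n)) (sym (X^⊛-+ p (# S?) m)))
    where
    open _≜_⊎[_∷_] P≜
    qs = filter Q? (partitions (p + m))
    ss = map (p ∷_) (filter S? (partitions m))
    disj : ∀ {z} → ¬ (z ∈ qs × z ∈ ss)
    disj (z∈qs , z∈ss) with _ , _ , refl ← ∈-map⁻ (p ∷_) z∈ss =
      disjoint (proj₂ (Equivalence.to (∈-count Q? (p + m)) z∈qs))
    to : ∀ {z} → z ∈ filter P? (partitions (p + m)) → z ∈ qs ++ ss
    to z∈ with Equivalence.to (∈-count P? (p + m)) z∈
    ... | part , pz with split pz
    ...   | inj₁ q = ∈-++⁺ˡ (Equivalence.from (∈-count Q? (p + m)) (part , q))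
    ...   | inj₂ (μs , refl , s) with part
    ...     | linked , _ ∷ pos , eq =
      ∈-++⁺ʳ qs (∈-map⁺ (p ∷_) (Equivalence.from (∈-count S? m)
        ((Linked.tail linked , pos , ℕ.+-cancelˡ-≡ p _ _ eq) , s)))
    from : ∀ {z} → z ∈ qs ++ ss → z ∈ filter P? (partitions (p + m))
    from z∈ with ∈-++⁻ qs z∈
    ... | inj₁ z∈qs = let part , q = Equivalence.to (∈-count Q? (p + m)) z∈qs
                      in Equivalence.from (∈-count P? (p + m)) (part , left q)
    ... | inj₂ z∈ss with μs , μs∈ , refl ← ∈-map⁻ (p ∷_) z∈ss =
      let (_ , pos , eq) , s = Equivalence.to (∈-count S? m) μs∈
      in Equivalence.from (∈-count P? (p + m)) ((sorted s , 1≤p ∷ pos , cong (_+_ p) eq) , right s)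

-- Partitions given by a relation between neighbouring parts.

module Chains
  (N : ℕ) {V : Pred ℕ 0ℓ} (V? : Decidable V) {R : Rel ℕ 0ℓ} (R? : Decidable₂ R)
  (V⇒1≤ : ∀ {p} → V p → 1 ≤ p) (R⇒≥ : ∀ {p q} → R p q → p ≥ q) (R-refl : ∀ {p} → R p p)
  where

  open Powers N
  open Continuant (seriesRing N) X N X^N≈0
  open CommutativeRing (seriesRing N) using (_≈_; +-congˡ; *-congˡ; *-assoc; setoid)
  open import Relation.Binary.Reasoning.Setoid setoid

  Chain : Pred (List ℕ) 0ℓ
  Chain λs = Linked R λs × All V λs

  chain? : Decidable Chain
  chain? λs = linked? R? λs ×-dec all? V? λs

  ChainFrom : Pred ℕ 0ℓ → Pred (List ℕ) 0ℓ
  ChainFrom H λs = Chain λs × Maybe.All H (head λs)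

  chainFrom? : ∀ {H} → Decidable H → Decidable (ChainFrom H)
  chainFrom? H? λs = chain? λs ×-dec Maybe.dec H? (head λs)

  tail : ∀ {p λs} → Chain (p ∷ λs) → Chain λs
  tail (linked , _ ∷ vs) = Linked.tail linked , vs

  chain⇒sorted : ∀ {λs} → Chain λs → Linked _≥_ λs
  chain⇒sorted = Linked.map R⇒≥ ∘ proj₁

  -- G allows the heads in H and also p; the part p may be followed by p itself and the parts in K.
  #-extend : ∀ p .{{_ : NonZero p}} → V p →
    ∀ {G H K} (G? : Decidable G) (H? : Decidable H) (K? : Decidable K) →
    (∀ {q} → V q → G q → H q ⊎ q ≡ p) → (∀ {q} → V q → H q → G q) → G p → ¬ H p →
    (∀ {q} → V q → R p q → K q ⊎ q ≡ p) → (∀ {q} → V q → K q → R p q) → ¬ K p →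
    # chainFrom? G? ≈ # chainFrom? H? ⊕ W p ⊛ # chainFrom? K?
  #-extend p vp {G} {H} {K} G? H? K? G⇒ H⇒G gp ¬hp R⇒ K⇒R ¬kp = begin
    # chainFrom? G?
      ≈⟨ (λ n _ → #-split N first (V⇒1≤ vp) (chainFrom? G?) (chainFrom? H?) after? n) ⟩
    # chainFrom? H? ⊕ X ^ p ⊛ # after?
      ≈⟨ +-congˡ {# chainFrom? H?} (*-congˡ {X ^ p} (Y-unique p
           (λ n _ → #-split N second (V⇒1≤ vp) after? (chainFrom? K?) after? n))) ⟩
    # chainFrom? H? ⊕ X ^ p ⊛ (Y p ⊛ # chainFrom? K?)
      ≈⟨ +-congˡ {# chainFrom? H?} (*-assoc (X ^ p) (Y p) (# chainFrom? K?)) ⟨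
    # chainFrom? H? ⊕ W p ⊛ # chainFrom? K? ∎
    where
    after? : Decidable (Chain ∘ (p ∷_))
    after? λs = chain? (p ∷ λs)
    first : ChainFrom G ≜ ChainFrom H ⊎[ p ∷ Chain ∘ (p ∷_) ]
    first = record
      { split = split ; left = left ; right = λ s → s , just gp
      ; disjoint = λ { (_ , just hp) → ¬hp hp } ; sorted = chain⇒sorted }
      where
      split : ∀ {λs} → ChainFrom G λs → ChainFrom H λs ⊎ (∃[ μs ] λs ≡ p ∷ μs × Chain (p ∷ μs))
      split {[]}     (c , _) = inj₁ (c , nothing)
      split {q ∷ μs} (c@(_ , vq ∷ _) , just g) with G⇒ vq g
      ... | inj₁ h    = inj₁ (c , just h)
      ... | inj₂ refl = inj₂ (μs , refl , c)
      left : ∀ {λs} → ChainFrom H λs → ChainFrom G λs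
      left {[]}    (c , _) = c , nothing
      left {_ ∷ _} (c@(_ , vq ∷ _) , just h) = c , just (H⇒G vq h)
    -- What follows `p` is empty, starts in `K`, or starts with `p` again: this is the equation f =
    -- g + q^p f that `Y-unique` solves.
    second : (Chain ∘ (p ∷_)) ≜ ChainFrom K ⊎[ p ∷ Chain ∘ (p ∷_) ]
    second = record
      { split = split ; left = left
      ; right = λ { (linked , vs@(v ∷ _)) → (R-refl ∷ linked) , (v ∷ vs) }
      ; disjoint = λ { (_ , just kp) → ¬kp kp } ; sorted = chain⇒sorted }
      where
      split : ∀ {λs} → Chain (p ∷ λs) → ChainFrom K λs ⊎ (∃[ μs ] λs ≡ p ∷ μs × Chain (p ∷ μs))
      split {[]}     c = inj₁ (tail c , nothing)
      split {q ∷ μs} c@(r ∷ _ , _ ∷ vq ∷ _) with R⇒ vq r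
      ... | inj₁ k    = inj₁ (tail c , just k)
      ... | inj₂ refl = inj₂ (μs , refl , tail c)
      left : ∀ {λs} → ChainFrom K λs → Chain (p ∷ λs)
      left {[]}    _ = [-] , vp ∷ []
      left {_ ∷ _} ((linked , vs@(vq ∷ _)) , just k) = (K⇒R vq k ∷ linked) , vp ∷ vs

  #-cong : ∀ {G H} (G? : Decidable G) (H? : Decidable H) →
           (∀ {q} → V q → G q → H q) → (∀ {q} → V q → H q → G q) →
           # chainFrom? G? ≈ # chainFrom? H?
  #-cong G? H? G⇒H H⇒G n _ =
    cong +_ (count-cong (chainFrom? G?) (chainFrom? H?) n (λ _ → convert G⇒H) (λ _ → convert H⇒G))
    where
    convert : ∀ {G H λs} → (∀ {q} → V q → G q → H q) → ChainFrom G λs → ChainFrom H λs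
    convert {λs = []}    _   (c , _)                 = c , nothing
    convert {λs = _ ∷ _} G⇒H (c@(_ , v ∷ _) , just g) = c , just (G⇒H v g)

  #-empty : ∀ {H} (H? : Decidable H) → (∀ {q} → V q → ¬ H q) → # chainFrom? H? ≈ 1ₛ
  #-empty H? ¬H zero    _ = refl
  #-empty {H} H? ¬H (suc n) _ =
    cong +_ (unique-length {ys = []} (count-unique (chainFrom? H?) (suc n)) [] none (λ ()))
    where
    none : ∀ {z} → z ∈ filter (chainFrom? H?) (partitions (suc n)) → z ∈ []
    none z∈ with Equivalence.to (∈-count (chainFrom? H?) (suc n)) z∈
    none {_ ∷ _} z∈ | _ , (_ , v ∷ _) , just h = contradiction h (¬H v)

≤-step⁻ : ∀ {b q} → q ≤ suc b → q ≤ b ⊎ q ≡ suc b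
≤-step⁻ q≤ with ℕ.m≤n⇒m<n∨m≡n q≤
... | inj₁ (s≤s q≤b) = inj₁ q≤b
... | inj₂ q≡        = inj₂ q≡

-- Partitions with gap conditions, counted by the continuant along 1, 3, 5, 4, 6, 8, ....

GapPart : Pred ℕ 0ℓ
GapPart p = 1 ≤ p × p ≢ 2

GapStep : Rel ℕ 0ℓ
GapStep p q = p ≥ q × AdjacentOK p q

gapStep-refl : ∀ {p} → GapStep p p
gapStep-refl {p} = ℕ.≤-refl
  , (λ eq → contradiction eq (ℕ.<⇒≢ (ℕ.m<m+n p (s≤s z≤n))))
  , (λ eq → contradiction eq (ℕ.<⇒≢ (ℕ.m<m+n p (s≤s z≤n))))

module GapCount (N : ℕ) where
  open Continuant (seriesRing N) X N (Powers.X^N≈0 N)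
  open Chains N {GapPart} (λ p → 1 ≤? p ×-dec ¬? (p ≟ 2))
              {GapStep} (λ p q → p ≥? q ×-dec adjacentOK? p q)
              proj₁ proj₁ gapStep-refl public
  open CommutativeRing (seriesRing N)
    using (_≈_; +-cong; +-congˡ; +-congʳ; +-assoc; +-comm; *-cong; setoid)
  open import Relation.Binary.Reasoning.Setoid setoid

  ≤-count : ℕ → Series
  ≤-count b = # chainFrom? (_≤? b)

  -- The parts that may follow 3 + k * 3 besides itself: 2 + k * 3 is allowed by (a), while 1 + k *
  -- 3 is two less and excluded by (b). Together with the absence of 2, these are the first 3 k
  -- terms of the path, where 5 precedes 4.
  Skips : ℕ → Pred ℕ 0ℓ
  Skips k q = q ≤ 2 + k * 3 × q ≢ 1 + k * 3

  skips? : ∀ k → Decidable (Skips k)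
  skips? k q = q ≤? (2 + k * 3) ×-dec ¬? (q ≟ 1 + k * 3)

  skip-count : ℕ → Series
  skip-count k = # chainFrom? (skips? k)

  mod : ∀ i k → (i + k * 3) % 3 ≡ i % 3
  mod i k = [m+kn]%n≡m%n i k 3

  p≡1+q : ∀ {p q} → p ≡ q + 1 → p ≡ suc q
  p≡1+q {q = q} eq = trans eq (ℕ.+-comm q 1)

  p≡2+q : ∀ {p q} → p ≡ q + 2 → p ≡ suc (suc q)
  p≡2+q {q = q} eq = trans eq (ℕ.+-comm q 2)

  -- Every smaller part may follow 1 + k * 3: those one and two below it are congruent to 0 and 2
  -- modulo 3, as (a) and (b) permit.
  1+-count : ∀ k → ≤-count (1 + k * 3) ≈ ≤-count (k * 3) ⊕ W (1 + k * 3) ⊛ ≤-count (k * 3)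
  1+-count k = #-extend (1 + k * 3)
    (s≤s z≤n , λ eq → contradiction (trans (sym (mod 1 k)) (cong (_% 3) eq)) λ ())
    (_≤? (1 + k * 3)) (_≤? (k * 3)) (_≤? (k * 3))
    (λ _ → ≤-step⁻) (λ _ → ℕ.m≤n⇒m≤1+n) ℕ.≤-refl (ℕ.<-irrefl refl)
    (λ _ → ≤-step⁻ ∘ proj₁)
    (λ _ q≤ → ℕ.m≤n⇒m≤1+n q≤
      , (λ eq → one (ℕ.suc-injective (p≡1+q eq))) , (λ eq → two k (ℕ.suc-injective (p≡2+q eq))))
    (ℕ.<-irrefl refl)
    where
    one : ∀ {q} → k * 3 ≡ q → q % 3 ≢ 1
    one refl eq = contradiction (trans (sym (mod 0 k)) eq) λ ()
    two : ∀ k {q} → k * 3 ≡ suc q → q % 3 ≡ 2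
    two (suc k) refl = mod 2 k

  2+-step⁺ : ∀ k {q} → q ≤ 2 + k * 3 → GapStep (5 + k * 3) q
  2+-step⁺ k q≤ = ℕ.≤-trans q≤ (ℕ.m≤n+m _ 3)
    , (λ eq → contradiction (subst (_≤ 2 + k * 3) (sym (ℕ.suc-injective (p≡1+q eq))) q≤)
                            (ℕ.<⇒≱ (ℕ.m≤n+m _ 1)))
    , (λ eq → contradiction (subst (_≤ 2 + k * 3) (sym (ℕ.suc-injective (ℕ.suc-injective (p≡2+q eq)))) q≤)
                            (ℕ.<⇒≱ ℕ.≤-refl))

  -- The part 4 + k * 3 is one less and congruent to 1, against (a); 3 + k * 3 is two less and
  -- congruent to 0, against (b). The class starts at 5, as 2 is no part.
  2+-step⁻ : ∀ k {q} → GapStep (5 + k * 3) q → q ≤ 2 + k * 3 ⊎ q ≡ 5 + k * 3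
  2+-step⁻ k (q≤ , ok₁ , ok₂) with ≤-step⁻ q≤
  ... | inj₂ refl = inj₂ refl
  ... | inj₁ q≤4 with ≤-step⁻ q≤4
  ...   | inj₂ refl = contradiction (mod 4 k) (ok₁ (ℕ.+-comm 1 (4 + k * 3)))
  ...   | inj₁ q≤3 with ≤-step⁻ q≤3
  ...     | inj₂ refl = contradiction (trans (sym (mod 3 k)) (ok₂ (ℕ.+-comm 2 (3 + k * 3)))) λ ()
  ...     | inj₁ q≤2 = inj₁ q≤2

  5+-part : ∀ k → GapPart (5 + k * 3)
  5+-part k = s≤s z≤n , λ ()

  2+-count : ∀ k → ≤-count (5 + k * 3) ≈ ≤-count (4 + k * 3) ⊕ W (5 + k * 3) ⊛ ≤-count (2 + k * 3)
  2+-count k = #-extend (5 + k * 3) (5+-part k) (_≤? (5 + k * 3)) (_≤? (4 + k * 3)) (_≤? (2 + k * 3))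
    (λ _ → ≤-step⁻) (λ _ → ℕ.m≤n⇒m≤1+n) ℕ.≤-refl (ℕ.<-irrefl refl)
    (λ _ → 2+-step⁻ k) (λ _ → 2+-step⁺ k) (ℕ.<⇒≱ (ℕ.m≤n+m _ 2))

  skip-suc : ∀ k → skip-count (suc k) ≈ ≤-count (3 + k * 3) ⊕ W (5 + k * 3) ⊛ ≤-count (2 + k * 3)
  skip-suc k = #-extend (5 + k * 3) (5+-part k) (skips? (suc k)) (_≤? (3 + k * 3)) (_≤? (2 + k * 3))
    (λ _ → split) (λ _ q≤ → ℕ.≤-trans q≤ (ℕ.m≤n+m _ 2) , λ eq → ℕ.<-irrefl eq (s≤s q≤))
    (ℕ.≤-refl , ℕ.1+n≢n) (ℕ.<⇒≱ (ℕ.m≤n+m _ 1))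
    (λ _ → 2+-step⁻ k) (λ _ → 2+-step⁺ k) (ℕ.<⇒≱ (ℕ.m≤n+m _ 2))
    where
    split : ∀ {q} → Skips (suc k) q → q ≤ 3 + k * 3 ⊎ q ≡ 5 + k * 3
    split (q≤5 , q≢4) with ≤-step⁻ q≤5
    ... | inj₂ q≡5 = inj₂ q≡5
    ... | inj₁ q≤4 with ≤-step⁻ q≤4
    ...   | inj₁ q≤3 = inj₁ q≤3
    ...   | inj₂ q≡4 = contradiction q≡4 q≢4

  -- By size 4 + k * 3 is inserted before 5 + k * 3, along the path after it. The two exclude each
  -- other, so their contributions are merely added in the other order. For k = 0 only the part 1 is
  -- inserted.
  2+-skip : ∀ k → ≤-count (2 + k * 3) ≈ skip-count k ⊕ W (1 + k * 3) ⊛ ≤-count (k * 3)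
  2+-skip zero = begin
    ≤-count 2                   ≈⟨ #-cong (_≤? 2) (_≤? 1) ≢2 (λ _ → ℕ.m≤n⇒m≤1+n) ⟩
    ≤-count 1                   ≈⟨ 1+-count 0 ⟩
    ≤-count 0 ⊕ W 1 ⊛ ≤-count 0
      ≈⟨ +-congʳ {W 1 ⊛ ≤-count 0} (#-cong (_≤? 0) (skips? 0)
           (λ v q≤0 → contradiction (proj₁ v) (ℕ.<⇒≱ (s≤s q≤0))) ≡0) ⟩
    skip-count 0 ⊕ W 1 ⊛ ≤-count 0 ∎
    where
    ≢2 : ∀ {q} → GapPart q → q ≤ 2 → q ≤ 1
    ≢2 (_ , q≢2) q≤2 with ≤-step⁻ q≤2
    ... | inj₁ q≤1 = q≤1
    ... | inj₂ q≡2 = contradiction q≡2 q≢2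
    ≡0 : ∀ {q} → GapPart q → Skips 0 q → q ≤ 0
    ≡0 v (q≤2 , q≢1) with ≤-step⁻ (≢2 v q≤2)
    ... | inj₁ q≤0 = q≤0
    ... | inj₂ q≡1 = contradiction q≡1 q≢1
  2+-skip (suc k) = begin
    ≤-count (5 + k * 3)    ≈⟨ 2+-count k ⟩
    ≤-count (4 + k * 3) ⊕ b  ≈⟨ +-congʳ {b} (1+-count (suc k)) ⟩
    (z ⊕ a) ⊕ b            ≈⟨ +-assoc z a b ⟩
    z ⊕ (a ⊕ b)            ≈⟨ +-congˡ {z} (+-comm a b) ⟩
    z ⊕ (b ⊕ a)            ≈⟨ +-assoc z b a ⟨
    (z ⊕ b) ⊕ a            ≈⟨ +-congʳ {a} (skip-suc k) ⟨
    skip-count (suc k) ⊕ a ∎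
    where
    z = ≤-count (3 + k * 3)
    a = W (4 + k * 3) ⊛ ≤-count (3 + k * 3)
    b = W (5 + k * 3) ⊛ ≤-count (2 + k * 3)

  3+-count : ∀ k → ≤-count (3 + k * 3) ≈ ≤-count (2 + k * 3) ⊕ W (3 + k * 3) ⊛ skip-count k
  3+-count k = #-extend (3 + k * 3) (s≤s z≤n , λ ()) (_≤? (3 + k * 3)) (_≤? (2 + k * 3)) (skips? k)
    (λ _ → ≤-step⁻) (λ _ → ℕ.m≤n⇒m≤1+n) ℕ.≤-refl (ℕ.<-irrefl refl)
    (λ _ → step⁻) (λ _ → step⁺) (ℕ.<-irrefl refl ∘ proj₁)
    where
    step⁻ : ∀ {q} → GapStep (3 + k * 3) q → Skips k q ⊎ q ≡ 3 + k * 3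
    step⁻ (q≤ , _ , ok₂) with ≤-step⁻ q≤
    ... | inj₂ q≡  = inj₂ q≡
    ... | inj₁ q≤2 = inj₁ (q≤2 , λ { refl →
      contradiction (trans (sym (mod 1 k)) (ok₂ (ℕ.+-comm 2 (1 + k * 3)))) λ () })
    step⁺ : ∀ {q} → Skips k q → GapStep (3 + k * 3) q
    step⁺ {q} (q≤ , q≢) = ℕ.m≤n⇒m≤1+n q≤
      , (λ eq q%3≡1 → contradiction
          (trans (sym (mod 2 k)) (trans (cong (_% 3) (ℕ.suc-injective (p≡1+q eq))) q%3≡1)) λ ())
      , (λ eq → contradiction (sym (ℕ.suc-injective (ℕ.suc-injective (p≡2+q eq)))) q≢)

  -- A joint induction over the three residues of the length. Each new term of the path excludes
  -- only its predecessor, which is the recursion `κ-snoc`; the value at length -1 matches the case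
  -- without parts.
  ≤-count≈κ : ∀ k → ≤-count (k * 3) ≈ κ 1 3 5 (k * 3)
  skip-count≈κ : ∀ k → skip-count k ≈ κ 1 3 5 (1 + k * 3)
  2+-count≈κ : ∀ k → ≤-count (2 + k * 3) ≈ κ 1 3 5 (2 + k * 3)

  ≤-count≈κ zero = #-empty (_≤? 0) (λ v q≤0 → contradiction (proj₁ v) (ℕ.<⇒≱ (s≤s q≤0)))
  ≤-count≈κ (suc k) = begin
    ≤-count (3 + k * 3)  ≈⟨ 3+-count k ⟩
    ≤-count (2 + k * 3) ⊕ W (3 + k * 3) ⊛ skip-count k
      ≈⟨ +-cong (2+-count≈κ k) (*-cong (W-congʳ (sym (path-*3 3 5 4 k))) (skip-count≈κ k)) ⟩
    κ 1 3 5 (2 + k * 3) ⊕ W (path 3 5 4 (k * 3)) ⊛ κ 1 3 5 (1 + k * 3)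
      ≈⟨ κ-snoc 1 3 5 (1 + k * 3) ⟨
    κ 1 3 5 (3 + k * 3) ∎

  skip-count≈κ zero = #-empty (skips? 0) λ { (1≤q , q≢2) (q≤2 , q≢1) → absurd 1≤q q≢2 q≤2 q≢1 }
    where
    absurd : ∀ {q} → 1 ≤ q → q ≢ 2 → q ≤ 2 → ¬ q ≢ 1
    absurd {1} _ _ _ q≢1 = q≢1 refl
    absurd {2} _ q≢2 _ _ = q≢2 refl
    absurd {suc (suc (suc _))} _ _ (s≤s (s≤s ())) _
  skip-count≈κ (suc k) = begin
    skip-count (suc k)  ≈⟨ skip-suc k ⟩
    ≤-count (3 + k * 3) ⊕ W (5 + k * 3) ⊛ ≤-count (2 + k * 3)
      ≈⟨ +-cong (≤-count≈κ (suc k)) (*-cong (W-congʳ (sym (path-*3 5 4 6 k))) (2+-count≈κ k)) ⟩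
    κ 1 3 5 (3 + k * 3) ⊕ W (path 5 4 6 (k * 3)) ⊛ κ 1 3 5 (2 + k * 3)
      ≈⟨ κ-snoc 1 3 5 (2 + k * 3) ⟨
    κ 1 3 5 (4 + k * 3) ∎

  2+-count≈κ k = begin
    ≤-count (2 + k * 3)  ≈⟨ 2+-skip k ⟩
    skip-count k ⊕ W (1 + k * 3) ⊛ ≤-count (k * 3)
      ≈⟨ +-cong (skip-count≈κ k) (*-cong (W-congʳ (sym (path-*3 1 3 5 k))) (≤-count≈κ k)) ⟩
    κ 1 3 5 (1 + k * 3) ⊕ W (path 1 3 5 (k * 3)) ⊛ κ 1 3 5 (k * 3)
      ≈⟨ κ-snoc 1 3 5 (k * 3) ⟨
    κ 1 3 5 (2 + k * 3) ∎

-- Partitions into parts congruent to 0, 1, 3 or 5 modulo 6.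

Residue : Pred ℕ 0ℓ
Residue r = r ≡ 0 ⊎ r ≡ 1 ⊎ r ≡ 3 ⊎ r ≡ 5

residue? : Decidable Residue
residue? r = r ≟ 0 ⊎-dec r ≟ 1 ⊎-dec r ≟ 3 ⊎-dec r ≟ 5

ModPart : Pred ℕ 0ℓ
ModPart p = 1 ≤ p × Residue (p % 6)

module ModCount (N : ℕ) where
  open Continuant (seriesRing N) X N (Powers.X^N≈0 N)
  open Chains N {ModPart} (λ p → 1 ≤? p ×-dec residue? (p % 6)) {_≥_} _≥?_
              proj₁ id ℕ.≤-refl public
  open CommutativeRing (seriesRing N)
    using (_≈_; *-cong; *-congˡ; *-congʳ; *-identityˡ; distribʳ; +-congʳ; setoid; commutativeSemiring)
    renaming (sym to ≈-sym; refl to ≈-refl)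
  open SemiringSolver commutativeSemiring using (solve; _:=_; _:*_)
  open import Relation.Binary.Reasoning.Setoid setoid

  ≤-count : ℕ → Series
  ≤-count b = # chainFrom? (_≤? b)

  keep : ∀ b → Residue (suc b % 6) → ≤-count (suc b) ≈ Y (suc b) ⊛ ≤-count b
  keep b res = begin
    ≤-count (suc b)
      ≈⟨ #-extend (suc b) (s≤s z≤n , res) (_≤? suc b) (_≤? b) (_≤? b)
           (λ _ → ≤-step⁻) (λ _ → ℕ.m≤n⇒m≤1+n) ℕ.≤-refl (ℕ.<-irrefl refl)
           (λ _ → ≤-step⁻) (λ _ → ℕ.m≤n⇒m≤1+n) (ℕ.<-irrefl refl) ⟩
    ≤-count b ⊕ W (suc b) ⊛ ≤-count b       ≈⟨ +-congʳ {W (suc b) ⊛ ≤-count b} (*-identityˡ (≤-count b)) ⟨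
    1ₛ ⊛ ≤-count b ⊕ W (suc b) ⊛ ≤-count b  ≈⟨ distribʳ (≤-count b) 1ₛ (W (suc b)) ⟨
    (1ₛ ⊕ W (suc b)) ⊛ ≤-count b            ≈⟨ *-congʳ (Y≈1+W (suc b)) ⟨
    Y (suc b) ⊛ ≤-count b                   ∎

  skip : ∀ b → ¬ Residue (suc b % 6) → ≤-count (suc b) ≈ ≤-count b
  skip b ¬res = #-cong (_≤? suc b) (_≤? b) drop (λ _ → ℕ.m≤n⇒m≤1+n)
    where
    drop : ∀ {q} → ModPart q → q ≤ suc b → q ≤ b
    drop (_ , res) q≤ with ≤-step⁻ q≤
    ... | inj₁ q≤b  = q≤b
    ... | inj₂ refl = contradiction res ¬res

  -- Six sizes at a time: 4 and 2 modulo 6 give nothing, 1 and 5 extend `Π₁₅`, and the two multiples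
  -- of 3 extend `Π₃` twice, whence r * 2.
  ≤-count≈Π : ∀ r → ≤-count (r * 6) ≈ Π₁₅ r ⊛ Π₃ (r * 2)
  ≤-count≈Π zero = begin
    ≤-count 0  ≈⟨ #-empty (_≤? 0) (λ v q≤0 → contradiction (proj₁ v) (ℕ.<⇒≱ (s≤s q≤0))) ⟩
    1ₛ         ≈⟨ *-identityˡ 1ₛ ⟨
    1ₛ ⊛ 1ₛ    ∎
  ≤-count≈Π (suc r) = begin
    ≤-count (6 + r * 6)            ≈⟨ keep (5 + r * 6) (subst Residue (sym (mod 6)) (inj₁ refl)) ⟩
    y₆ ⊛ ≤-count (5 + r * 6)       ≈⟨ *-congˡ {y₆} (keep (4 + r * 6) (subst Residue (sym (mod 5)) (inj₂ (inj₂ (inj₂ refl))))) ⟩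
    y₆ ⊛ (y₅ ⊛ ≤-count (4 + r * 6))
      ≈⟨ *-congˡ {y₆} (*-congˡ {y₅} (skip (3 + r * 6) (λ res → 4∉ (subst Residue (mod 4) res)))) ⟩
    y₆ ⊛ (y₅ ⊛ ≤-count (3 + r * 6))
      ≈⟨ *-congˡ {y₆} (*-congˡ {y₅} (keep (2 + r * 6) (subst Residue (sym (mod 3)) (inj₂ (inj₂ (inj₁ refl)))))) ⟩
    y₆ ⊛ (y₅ ⊛ (y₃ ⊛ ≤-count (2 + r * 6)))
      ≈⟨ *-congˡ {y₆} (*-congˡ {y₅} (*-congˡ {y₃} (skip (1 + r * 6) (λ res → 2∉ (subst Residue (mod 2) res))))) ⟩
    y₆ ⊛ (y₅ ⊛ (y₃ ⊛ ≤-count (1 + r * 6)))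
      ≈⟨ *-congˡ {y₆} (*-congˡ {y₅} (*-congˡ {y₃} (keep (r * 6) (subst Residue (sym (mod 1)) (inj₂ (inj₁ refl)))))) ⟩
    y₆ ⊛ (y₅ ⊛ (y₃ ⊛ (y₁ ⊛ ≤-count (r * 6))))
      ≈⟨ *-congˡ {y₆} (*-congˡ {y₅} (*-congˡ {y₃} (*-congˡ {y₁} (≤-count≈Π r)))) ⟩
    y₆ ⊛ (y₅ ⊛ (y₃ ⊛ (y₁ ⊛ (Π₁₅ r ⊛ Π₃ (r * 2)))))
      ≈⟨ solve 6 (λ a b c d e f → a :* (b :* (c :* (d :* (e :* f)))) := (e :* (d :* b)) :* (a :* (c :* f)))
           ≈-refl y₆ y₅ y₃ y₁ (Π₁₅ r) (Π₃ (r * 2)) ⟩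
    Π₁₅ (suc r) ⊛ (y₆ ⊛ (y₃ ⊛ Π₃ (r * 2)))
      ≈⟨ *-congˡ {Π₁₅ (suc r)} (*-cong (Y-congʳ (6*r 6)) (*-congʳ (Y-congʳ (6*r 3)))) ⟩
    Π₁₅ (suc r) ⊛ Π₃ (suc r * 2)   ∎
    where
    y₁ = Y (1 + r * 6)
    y₃ = Y (3 + r * 6)
    y₅ = Y (5 + r * 6)
    y₆ = Y (6 + r * 6)
    mod : ∀ i → (i + r * 6) % 6 ≡ i % 6
    mod i = [m+kn]%n≡m%n i r 6
    2∉ : ¬ Residue 2
    2∉ (inj₂ (inj₂ (inj₁ ())))
    4∉ : ¬ Residue 4
    4∉ (inj₂ (inj₂ (inj₁ ())))
    6*r : ∀ i → i + r * 6 ≡ i + r * 2 * 3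
    6*r i = cong (_+_ i) (sym (ℕ.*-assoc r 2 3))

-- Comparison of the two counts at a given n.

head≤ : ∀ {n b λs} → n ≤ b → IsPartition n λs → Maybe.All (_≤ b) (head λs)
head≤ {λs = []}     n≤b _              = nothing
head≤ {λs = p ∷ μs} n≤b (_ , _ , refl) = just (ℕ.≤-trans (ℕ.m≤m+n p (sum μs)) n≤b)

theorem1p3 : (n : ℕ) → C₁ n ≡ C₂ n
theorem1p3 n = ℤ.+-injective (trans (cong +_ c₁) (trans (series≈ n r≤N) (cong +_ (sym c₂))))
  where
  -- `N` exceeds `n`, so the coefficient at `n` is among those compared, and it is a multiple of 6
  -- to complete the last round of factors. The bound `b` is the length at which `κ-product`
  -- evaluates the continuant. No part of a partition of `n` exceeds `N` or `b`, so bounding the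
  -- heads loses nothing.
  r = suc n
  N = r * 6
  b = 2 + r * 4 * 3
  module Mod = ModCount N
  module Gap = GapCount N
  open Continuant (seriesRing N) X N (Powers.X^N≈0 N)
  open CommutativeRing (seriesRing N) using (_≈_) renaming (trans to ≈-trans; sym to ≈-sym)

  r≤N : r ≤ N
  r≤N = ℕ.m≤m*n r 6

  n≤b : n ≤ b
  n≤b = ℕ.m≤n⇒m≤o+n 2 (ℕ.≤-trans (ℕ.n≤1+n n) (ℕ.≤-trans (ℕ.m≤m*n r 4) (ℕ.m≤m*n (r * 4) 3)))

  series≈ : Mod.≤-count N ≈ Gap.≤-count b
  series≈ = ≈-trans (Mod.≤-count≈Π r)
                    (≈-sym (≈-trans (Gap.2+-count≈κ (r * 4)) (κ-product r ℕ.≤-refl)))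

  c₁ : C₁ n ≡ count (Mod.chainFrom? (_≤? N)) n
  c₁ = count-cong partsMod6? (Mod.chainFrom? (_≤? N)) n
    (λ part@(linked , pos , _) res →
      (linked , All.zip (pos , res)) , head≤ (ℕ.≤-trans (ℕ.n≤1+n n) r≤N) part)
    (λ _ ((_ , vs) , _) → All.map proj₂ vs)

  c₂ : C₂ n ≡ count (Gap.chainFrom? (_≤? b)) n
  c₂ = count-cong gapConditions? (Gap.chainFrom? (_≤? b)) n
    (λ part@(linked , pos , _) (adj , ≢2) →
      (Linked.zip (linked , adj) , All.zip (pos , ≢2)) , head≤ n≤b part)
    (λ _ ((linked , vs) , _) → Linked.map proj₂ linked , All.map proj₂ vs)
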